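{- Let $k\ge 2$ and let $A_0A_1\ldots A_k$ be a (non-degenerate) $k$-simplex in $\mathbb{R}^n$ with integer vertices, all of whose edges have integer length $1$. Let $$\alpha=\angle(A_0;A_1,A_2,\ldots,A_k),\qquad \beta=\angle(A_1;A_0,A_2,\ldots,A_k),$$ and assume that $\alpha$ and $\beta$ are simple. Then $$\operatorname{lsin}_k\beta=\operatorname{lsin}_k\alpha,$$ $$\operatorname{lcos}_{1,k}\beta+\sum_{i=1}^{k-1}\operatorname{lcos}_{i,k}\alpha\equiv 1\pmod{\operatorname{lsin}_k\alpha},$$ $$\operatorname{lcos}_{x,k}\beta=\operatorname{lcos}_{x,k}\alpha\quad\text{for } x\in\{2,\ldots,k-1\}.$$
   Context: The integer length of a segment $AB$ with integer endpoints is the index of $\mathbb{Z}\cdot\overrightarrow{AB}$ in the group of integer vectors parallel to $AB$ (so it is $1$ iff $\overrightarrow{AB}$ is primitive). For integer points $B_0,B_1,\ldots,B_k$ with $\overrightarrow{B_0B_i}$ linearly independent, $\angle(B_0;B_1,\ldots,B_k)$ is the ordered rational $k$-cone with vertex $B_0$ whose $i$-th edge is the ray from $B_0$ through $B_i$. For an ordered rational $k$-cone $\alpha$ in $\mathbb{R}^n$ let $v_1,\ldots,v_k$ be the primitive integer vectors along its edges, in order, and let $\Gamma=\mathbb{Z}^n\cap\operatorname{span}_{\mathbb{R}}(v_1,\ldots,v_k)$. There is a unique $\mathbb{Z}$-basis $e_1,\ldots,e_k$ of $\Gamma$ such that $v_i=\sum_{j\le i}a_{j,i}e_j$ with $a_{i,i}>0$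 and $0\le a_{j,i}<a_{i,i}$ for $j<i$. The $i$-th integer sine is $\operatorname{lsin}_i\alpha=a_{i,i}$ and the $(j,i)$-th integer cosine ($j<i$) is $\operatorname{lcos}_{j,i}\alpha=a_{j,i}$. The integer sine of a rational $m$-cone $\gamma$ with primitive edge vectors $w_1,\ldots,w_m$ is the index $\operatorname{lsin}(\gamma)=[\mathbb{Z}^n\cap\operatorname{span}_{\mathbb{R}}(w_1,\ldots,w_m):\mathbb{Z}w_1+\cdots+\mathbb{Z}w_m]$. A rational $k$-cone is simple if every one of its $(k-1)$-dimensional faces (cones with the same vertex generated by $k-1$ of its edges) has integer sine $1$. -}

module Defs where

open import Algebra.Bundles using (Ring)
open import Data.Fin.Base using (Fin; punchIn; _<_)
open import Data.Integer.Base as ℤ using (ℤ; +_; 0ℤ)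
import Data.Integer.Properties as ℤₚ
open import Data.Integer.Divisibility using (_∣_)
open import Data.Nat.Base as ℕ using (ℕ; suc)
open import Data.Product.Base using (Σ-syntax; ∃-syntax; _×_)
open import Data.Product using (∃!)
open import Data.Rational.Base as ℚ using (ℚ; 0ℚ)
open import Data.Rational.Literals using (fromℤ)
import Data.Rational.Properties as ℚₚ
import Data.Rational.Unnormalised.Base as ℚᵘ
import Data.Rational.Unnormalised.Properties as ℚᵘₚ
open import Data.Vec.Functional using (Vector; insertAt; removeAt)
open import Data.Vec.Functional.Properties using (insertAt-lookup; insertAt-punchIn)
import Algebra.Properties.CommutativeMonoid.Sum ℚₚ.+-0-commutativeMonoid as ℚΣ⁺
import Algebra.Properties.Semiring.Sum (Ring.semiring ℚₚ.+-*-ring) as ℚΣ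
open import Algebra.Properties.CommutativeMonoid.Sum ℚₚ.+-0-commutativeMonoid public using ()
  renaming (sum to sumℚ)
open import Algebra.Properties.CommutativeMonoid.Sum ℤₚ.+-0-commutativeMonoid public using ()
  renaming (sum to sumℤ)
open import Relation.Binary.PropositionalEquality

private
  variable
    n k : ℕ

------------------------------------------------------------------------
-- Integer vectors.  Equality of vectors is pointwise equality _≗_.

infix 8 ℤ^_
ℤ^_ : ℕ → Set
ℤ^ n = Vector ℤ n

infixl 6 _-ᵥ_
_-ᵥ_ : ℤ^ n → ℤ^ n → ℤ^ n
(u -ᵥ w) x = u x ℤ.- w x

combℤ : Vector ℤ k → Vector (ℤ^ n) k → ℤ^ n
combℤ c v x = sumℤ (λ i → c i ℤ.* v i x)

combℚ : Vector ℚ k → Vector (ℤ^ n) k → Vector ℚ n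
combℚ c v x = sumℚ (λ i → c i ℚ.* fromℤ (v i x))

-- For integer vectors, linear independence over ℚ and over ℝ coincide.
LinearlyIndependent : Vector (ℤ^ n) k → Set
LinearlyIndependent v = ∀ c → (∀ x → combℚ c v x ≡ 0ℚ) → ∀ i → c i ≡ 0ℚ

AffinelyIndependent : Vector (ℤ^ n) k → Set
AffinelyIndependent A =
  ∀ c → sumℚ c ≡ 0ℚ → (∀ x → combℚ c A x ≡ 0ℚ) → ∀ i → c i ≡ 0ℚ

------------------------------------------------------------------------
-- Subgroups of ℤⁿ

-- ℤⁿ ∩ span(v).  An integer vector in the real span of integer vectors
-- already lies in their rational span, so rational coefficients suffice.
SpanLattice : Vector (ℤ^ n) k → ℤ^ n → Set
SpanLattice v w = ∃[ c ] (∀ x → combℚ c v x ≡ fromℤ (w x))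

ℤ-Span : Vector (ℤ^ n) k → ℤ^ n → Set
ℤ-Span v w = ∃[ c ] combℤ c v ≗ w

record IsℤBasis (G : ℤ^ n → Set) (e : Vector (ℤ^ n) k) : Set where
  field
    member      : ∀ i → G (e i)
    spanning    : ∀ {w} → G w → ℤ-Span e w
    independent : ∀ c → (∀ x → combℤ c e x ≡ 0ℤ) → ∀ i → c i ≡ 0ℤ

-- [G : H] = N : the representatives rep meet every coset of H in G
-- exactly once.
HasIndex : (G H : ℤ^ n → Set) → ℕ → Set
HasIndex {n} G H N =
  Σ[ rep ∈ Vector (ℤ^ n) N ]
    (∀ j → G (rep j)) × (∀ {g} → G g → ∃! _≡_ (λ j → H (g -ᵥ rep j)))

-- ℤⁿ ∩ span(AB) is the group of integer vectors parallel to AB.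
IntegerLength : ℤ^ n → ℤ^ n → ℕ → Set
IntegerLength {n} A B = HasIndex (SpanLattice AB) (ℤ-Span AB)
  where
  AB : Vector (ℤ^ n) 1
  AB _ = B -ᵥ A

------------------------------------------------------------------------
-- Independence of edges and of subfamilies of edges

private
  fromℤ-sub : ∀ i j → fromℤ (i ℤ.- j) ≡ fromℤ i ℚ.- fromℤ j
  fromℤ-sub i j = ℚₚ.toℚᵘ-injective (begin
    ℚ.toℚᵘ (fromℤ (i ℤ.- j))                    ≈⟨ ℚᵘ.*≡* (cong (ℤ._* + 1) (cong₂ ℤ._+_ (sym (ℤₚ.*-identityʳ i)) (sym (ℤₚ.*-identityʳ (ℤ.- j))))) ⟩
    ℚ.toℚᵘ (fromℤ i) ℚᵘ.- ℚ.toℚᵘ (fromℤ j)      ≈⟨ ℚᵘₚ.+-congʳ (ℚ.toℚᵘ (fromℤ i)) (ℚᵘₚ.≃-sym (ℚₚ.toℚᵘ-homo‿- (fromℤ j))) ⟩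
    ℚ.toℚᵘ (fromℤ i) ℚᵘ.+ ℚ.toℚᵘ (ℚ.- fromℤ j)  ≈⟨ ℚₚ.toℚᵘ-homo-+ (fromℤ i) (ℚ.- fromℤ j) ⟨
    ℚ.toℚᵘ (fromℤ i ℚ.- fromℤ j)                ∎)
    where open import Relation.Binary.Reasoning.Setoid ℚᵘₚ.≃-setoid

  sum-insertAt : ∀ (c : Vector ℚ k) (p : Fin (suc k)) (q : ℚ) (f : Vector ℚ (suc k)) →
    sumℚ (λ i → insertAt c p q i ℚ.* f i) ≡ q ℚ.* f p ℚ.+ sumℚ (λ i → c i ℚ.* f (punchIn p i))
  sum-insertAt c p q f = trans (ℚΣ⁺.sum-remove {i = p} (λ i → insertAt c p q i ℚ.* f i))
    (cong₂ ℚ._+_ (cong (ℚ._* f p) (insertAt-lookup c p q))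
      (ℚΣ⁺.sum-cong-≗ (λ i → cong (ℚ._* f (punchIn p i)) (insertAt-punchIn c p q i))))

removeAt-independent : (v : Vector (ℤ^ n) (suc k)) → LinearlyIndependent v →
  ∀ p → LinearlyIndependent (removeAt v p)
removeAt-independent v ind p c eq i =
  trans (sym (insertAt-punchIn c p 0ℚ i)) (ind (insertAt c p 0ℚ) eq′ (punchIn p i))
  where
  eq′ : ∀ x → combℚ (insertAt c p 0ℚ) v x ≡ 0ℚ
  eq′ x = trans (sum-insertAt c p 0ℚ (λ i → fromℤ (v i x)))
    (cong₂ ℚ._+_ (ℚₚ.*-zeroˡ (fromℤ (v p x))) (eq x))

edges-independent : (A : Vector (ℤ^ n) (suc k)) → AffinelyIndependent A →
  ∀ p → LinearlyIndependent (λ i → removeAt A p i -ᵥ A p)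
edges-independent A ind p c eq i =
  trans (sym (insertAt-punchIn c p q i)) (ind c′ sum-c′ comb-c′ (punchIn p i))
  where
  open ≡-Reasoning
  q = ℚ.- sumℚ c
  c′ = insertAt c p q

  sum-c′ : sumℚ c′ ≡ 0ℚ
  sum-c′ = begin
    sumℚ c′                              ≡⟨ ℚΣ⁺.sum-remove {i = p} c′ ⟩
    c′ p ℚ.+ sumℚ (removeAt c′ p)        ≡⟨ cong₂ ℚ._+_ (insertAt-lookup c p q) (ℚΣ⁺.sum-cong-≗ (insertAt-punchIn c p q)) ⟩
    q ℚ.+ sumℚ c                         ≡⟨ ℚₚ.+-inverseˡ (sumℚ c) ⟩
    0ℚ                                   ∎

  comb-c′ : ∀ x → combℚ c′ A x ≡ 0ℚ
  comb-c′ x = begin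
    combℚ c′ A x
      ≡⟨ sum-insertAt c p q (λ i → fromℤ (A i x)) ⟩
    q ℚ.* P ℚ.+ sumℚ (λ i → c i ℚ.* a i)
      ≡⟨ ℚₚ.+-comm (q ℚ.* P) _ ⟩
    sumℚ (λ i → c i ℚ.* a i) ℚ.+ q ℚ.* P
      ≡⟨ cong (sumℚ (λ i → c i ℚ.* a i) ℚ.+_) q*P ⟩
    sumℚ (λ i → c i ℚ.* a i) ℚ.+ sumℚ (λ i → c i ℚ.* ℚ.- P)
      ≡⟨ ℚΣ⁺.∑-distrib-+ (λ i → c i ℚ.* a i) (λ i → c i ℚ.* ℚ.- P) ⟨
    sumℚ (λ i → c i ℚ.* a i ℚ.+ c i ℚ.* ℚ.- P)
      ≡⟨ ℚΣ⁺.sum-cong-≗ (λ i → ℚₚ.*-distribˡ-+ (c i) (a i) (ℚ.- P)) ⟨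
    sumℚ (λ i → c i ℚ.* (a i ℚ.- P))
      ≡⟨ ℚΣ⁺.sum-cong-≗ (λ i → cong (c i ℚ.*_) (fromℤ-sub (A (punchIn p i) x) (A p x))) ⟨
    combℚ c (λ i → removeAt A p i -ᵥ A p) x
      ≡⟨ eq x ⟩
    0ℚ ∎
    where
    P = fromℤ (A p x)
    a : Vector ℚ _
    a i = fromℤ (A (punchIn p i) x)
    q*P : q ℚ.* P ≡ sumℚ (λ i → c i ℚ.* ℚ.- P)
    q*P = begin
      ℚ.- sumℚ c ℚ.* P            ≡⟨ ℚₚ.neg-distribˡ-* (sumℚ c) P ⟨
      ℚ.- (sumℚ c ℚ.* P)          ≡⟨ ℚₚ.neg-distribʳ-* (sumℚ c) P ⟩
      sumℚ c ℚ.* ℚ.- P            ≡⟨ ℚΣ.*-distribʳ-sum (ℚ.- P) c ⟩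
      sumℚ (λ i → c i ℚ.* ℚ.- P)  ∎

------------------------------------------------------------------------
-- Ordered rational cones

-- ∠ B₀ B _ is the ordered cone with vertex B₀ whose i-th edge is the ray
-- from B₀ through B i.  A cone is presented by points on its rays; all
-- invariants below depend only on the primitive vectors along the rays.
record OrderedCone (n k : ℕ) : Set where
  constructor ∠
  field
    vertex      : ℤ^ n
    point       : Vector (ℤ^ n) k
    independent : LinearlyIndependent (λ i → point i -ᵥ vertex)

  edge : Vector (ℤ^ n) k
  edge i = point i -ᵥ vertex

open OrderedCone public using (edge)

-- The coordinates have greatest common divisor 1; the zero vector is
-- excluded, as every d divides it.
Primitive : ℤ^ n → Set
Primitive v = ∀ (d : ℕ) → (∀ x → + d ∣ v x) → d ≡ 1

PrimitiveAlong : (u v : ℤ^ n) → Set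
PrimitiveAlong u v = Primitive v × ∃[ m ] 0 ℕ.< m × (∀ x → u x ≡ + m ℤ.* v x)

PrimitiveEdges : OrderedCone n k → Vector (ℤ^ n) k → Set
PrimitiveEdges α v = ∀ i → PrimitiveAlong (edge α i) (v i)

-- "The integer sine of γ is N"; the primitive edge vectors w are unique.
IntegerSine : OrderedCone n k → ℕ → Set
IntegerSine γ N =
  ∃[ w ] PrimitiveEdges γ w × HasIndex (SpanLattice w) (ℤ-Span w) N

-- The face of codimension 1 omitting the p-th edge.
facet : OrderedCone n (suc k) → Fin (suc k) → OrderedCone n k
facet α@(∠ B₀ B ind) p = ∠ B₀ (removeAt B p) (removeAt-independent (edge α) ind p)

Simple : OrderedCone n (suc k) → Set
Simple α = ∀ p → IntegerSine (facet α p) 1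

-- The basis e₁,…,e_k of ℤⁿ ∩ span(v) in which the matrix a of the
-- primitive edge vectors v (column i holds the coordinates of v i) is in
-- Hermite normal form.  Every cone has exactly one such a, so the integer
-- sines and cosines may be read off from any inhabitant.
record HermiteBasis (α : OrderedCone n k) : Set where
  field
    v         : Vector (ℤ^ n) k
    v-edges   : PrimitiveEdges α v
    e         : Vector (ℤ^ n) k
    basis     : IsℤBasis (SpanLattice v) e
    a         : Fin k → Fin k → ℤ
    expansion : ∀ i → combℤ (λ j → a j i) e ≗ v i
    upper     : ∀ {j i} → i < j → a j i ≡ 0ℤ
    diagonal  : ∀ i → 0ℤ ℤ.< a i i
    reduced   : ∀ {j i} → j < i → 0ℤ ℤ.≤ a j i × a j i ℤ.< a i i

lsin : {α : OrderedCone n k} → HermiteBasis α → Fin k → ℤ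
lsin H i = HermiteBasis.a H i i

-- Meaningful as the integer cosine lcos_{j,i} only for j < i.
lcos : {α : OrderedCone n k} → HermiteBasis α → Fin k → Fin k → ℤ
lcos H j i = HermiteBasis.a H j i

infix 4 _≡_[mod_]
_≡_[mod_] : ℤ → ℤ → ℤ → Set
x ≡ y [mod m ] = m ∣ x ℤ.- y

{-# OPTIONS --safe #-}

-- In a simple cone with primitive edge vectors v₁, …, v_k the vectors
-- v₁, …, v_{k-1} generate their facet lattice, so e_i = v_i for i < k and
-- N e_k = v_k − Σ_{j<k} a_j v_j.  If w lies in the cone's lattice and
-- M w = Σ b_j v_j with b_k = 1, then writing w = Σ y_j e_j gives M y_k = N and
-- b_j = M y_j − a_j for j < k.  The edges of β arise from those of α by the
-- involution v₁ ↦ −v₁, v_i ↦ v_i − v₁, so the last basis vector of either cone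
-- may serve as w in the other: the two sines divide each other, and the cosines
-- agree, up to the change of edge vectors, modulo the sine.

module Submission where

open import Defs
open import Algebra.Bundles using (Ring)
open import Data.Nat.Base as ℕ using (ℕ)
import Data.Nat.Properties as ℕₚ
import Data.Nat.Divisibility as ℕᵈ
open import Data.Fin.Base using (Fin; zero; suc; fromℕ; inject₁; punchIn; _<_)
import Data.Fin.Properties as Finₚ
open import Data.Fin.Induction using (<-wellFounded; Acc; acc)
open import Data.Fin.Patterns using (0F; 1F)
open import Data.Integer.Base as ℤ using (ℤ; +_; _+_; _*_; -_; 0ℤ; 1ℤ)
import Data.Integer.Properties as ℤₚ
open import Data.Integer.Divisibility using (_∣_)
open import Data.Integer.Divisibility.Signed using (divides; ∣⇒∣ᵤ)
open import Data.Integer.Tactic.RingSolver using (solve-∀)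
open import Data.Product.Base using (_×_; _,_; ∃-syntax; proj₁; proj₂)
open import Data.Rational.Base as ℚ using (ℚ; 1ℚ; 1/_)
open import Data.Rational.Literals using (fromℤ)
import Data.Rational.Properties as ℚₚ
import Data.Rational.Unnormalised.Base as ℚᵘ
import Data.Rational.Unnormalised.Properties as ℚᵘₚ
open import Data.Vec.Functional using (Vector; removeAt; insertAt; updateAt)
open import Data.Vec.Functional.Properties
  using (insertAt-lookup; insertAt-punchIn; updateAt-updates; updateAt-minimal)
open import Function.Base using (const; _∘_)
import Algebra.Properties.Semiring.Sum (Ring.semiring ℤₚ.+-*-ring) as ℤΣ
import Algebra.Properties.CommutativeMonoid.Sum ℤₚ.+-0-commutativeMonoid as ℤΣ⁺
import Algebra.Properties.Semiring.Sum (Ring.semiring ℚₚ.+-*-ring) as ℚΣ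
import Algebra.Properties.CommutativeMonoid.Sum ℚₚ.+-0-commutativeMonoid as ℚΣ⁺
open import Relation.Binary.Definitions using (tri<; tri≈; tri>)
open import Relation.Binary.PropositionalEquality
open import Relation.Nullary using (contradiction)
open ≡-Reasoning

private
  variable
    n k : ℕ

-- Casting integers into the rationals, and algebra of integer combinations.

-- Rational addition normalises its result, so the identity is checked on unnormalised fractions,
-- where it is a cross-multiplication with denominators 1.
fromℤ-+ : ∀ i j → fromℤ (i + j) ≡ fromℤ i ℚ.+ fromℤ j
fromℤ-+ i j = ℚₚ.toℚᵘ-injective (ℚᵘₚ.≃-trans
  (ℚᵘ.*≡* (cong (_* + 1) (cong₂ _+_ (sym (ℤₚ.*-identityʳ i)) (sym (ℤₚ.*-identityʳ j)))))
  (ℚᵘₚ.≃-sym (ℚₚ.toℚᵘ-homo-+ (fromℤ i) (fromℤ j))))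

fromℤ-* : ∀ i j → fromℤ (i * j) ≡ fromℤ i ℚ.* fromℤ j
fromℤ-* i j = ℚₚ.toℚᵘ-injective (ℚᵘₚ.≃-trans (ℚᵘ.*≡* refl)
  (ℚᵘₚ.≃-sym (ℚₚ.toℚᵘ-homo-* (fromℤ i) (fromℤ j))))

fromℤ-sum : (t : Vector ℤ k) → fromℤ (sumℤ t) ≡ sumℚ (fromℤ ∘ t)
fromℤ-sum {ℕ.zero}  t = refl
fromℤ-sum {ℕ.suc k} t =
  trans (fromℤ-+ (t zero) _) (cong (fromℤ (t zero) ℚ.+_) (fromℤ-sum (t ∘ suc)))

combℚ-fromℤ : (c : Vector ℤ k) (v : Vector (ℤ^ n) k) →
  ∀ x → combℚ (fromℤ ∘ c) v x ≡ fromℤ (combℤ c v x)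
combℚ-fromℤ c v x = sym (trans (fromℤ-sum (λ i → c i * v i x))
  (ℚΣ⁺.sum-cong-≗ (λ i → fromℤ-* (c i) (v i x))))

combℤ-congˡ : {c d : Vector ℤ k} (v : Vector (ℤ^ n) k) → c ≗ d → combℤ c v ≗ combℤ d v
combℤ-congˡ v c≗d x = ℤΣ⁺.sum-cong-≗ (λ i → cong (_* v i x) (c≗d i))

combℤ-congʳ : (c : Vector ℤ k) {v w : Vector (ℤ^ n) k} → (∀ i → v i ≗ w i) →
  combℤ c v ≗ combℤ c w
combℤ-congʳ c v≗w x = ℤΣ⁺.sum-cong-≗ (λ i → cong (c i *_) (v≗w i x))

combℤ-scale : ∀ M (c : Vector ℤ k) (v : Vector (ℤ^ n) k) x →
  M * combℤ c v x ≡ combℤ (λ i → M * c i) v x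
combℤ-scale M c v x = trans (ℤΣ.*-distribˡ-sum M (λ i → c i * v i x))
  (ℤΣ⁺.sum-cong-≗ (λ i → sym (ℤₚ.*-assoc M (c i) (v i x))))

combℤ-+ : (c d : Vector ℤ k) (v : Vector (ℤ^ n) k) → ∀ x →
  combℤ (λ i → c i + d i) v x ≡ combℤ c v x + combℤ d v x
combℤ-+ c d v x = trans
  (ℤΣ⁺.sum-cong-≗ (λ i → ℤₚ.*-distribʳ-+ (v i x) (c i) (d i)))
  (ℤΣ⁺.∑-distrib-+ (λ i → c i * v i x) (λ i → d i * v i x))

combℤ-neg : (c : Vector ℤ k) (v : Vector (ℤ^ n) k) → ∀ x →
  combℤ (λ i → - c i) v x ≡ - combℤ c v x
combℤ-neg c v x = begin
  combℤ (λ i → - c i) v x           ≡⟨ combℤ-congˡ v (λ i → ℤₚ.-1*i≡-i (c i)) x ⟨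
  combℤ (λ i → - 1ℤ * c i) v x      ≡⟨ combℤ-scale (- 1ℤ) c v x ⟨
  - 1ℤ * combℤ c v x                ≡⟨ ℤₚ.-1*i≡-i _ ⟩
  - combℤ c v x                     ∎

combℤ-remove : ∀ (c : Vector ℤ (ℕ.suc k)) (v : Vector (ℤ^ n) (ℕ.suc k)) r x →
  combℤ c v x ≡ c r * v r x + combℤ (removeAt c r) (removeAt v r) x
combℤ-remove c v r x = ℤΣ⁺.sum-remove {i = r} (λ i → c i * v i x)

combℤ-remove-zero : ∀ (c : Vector ℤ (ℕ.suc k)) (v : Vector (ℤ^ n) (ℕ.suc k)) r →
  c r ≡ 0ℤ → combℤ c v ≗ combℤ (removeAt c r) (removeAt v r)
combℤ-remove-zero c v r cr≡0 x = begin
  combℤ c v x          ≡⟨ combℤ-remove c v r x ⟩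
  c r * v r x + rest   ≡⟨ cong (λ z → z * v r x + rest) cr≡0 ⟩
  0ℤ * v r x + rest    ≡⟨ cong (_+ rest) (ℤₚ.*-zeroˡ (v r x)) ⟩
  0ℤ + rest            ≡⟨ ℤₚ.+-identityˡ rest ⟩
  rest                 ∎
  where rest = combℤ (removeAt c r) (removeAt v r) x

combℤ-zero : {c : Vector ℤ k} (v : Vector (ℤ^ n) k) → (∀ i → c i ≡ 0ℤ) →
  ∀ x → combℤ c v x ≡ 0ℤ
combℤ-zero {k} v c≡0 x = trans (combℤ-congˡ v c≡0 x) (ℤΣ.sum-replicate-zero k)

-- Independence is stated over ℚ: the difference of the coefficients is cast to ℚ, shown to vanish
-- there, and recovered by taking numerators.
combℤ-injective : (v : Vector (ℤ^ n) k) → LinearlyIndependent v →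
  ∀ {c d} → combℤ c v ≗ combℤ d v → c ≗ d
combℤ-injective v ind {c} {d} eq i = ℤₚ.i-j≡0⇒i≡j (c i) (d i) (cong ℚ.numerator
  (ind (λ i → fromℤ (c i ℤ.- d i)) (λ x → trans
    (combℚ-fromℤ (λ i → c i ℤ.- d i) v x) (cong fromℤ (zero-comb x))) i))
  where
  zero-comb : ∀ x → combℤ (λ i → c i ℤ.- d i) v x ≡ 0ℤ
  zero-comb x = begin
    combℤ (λ i → c i ℤ.- d i) v x             ≡⟨ combℤ-+ c (-_ ∘ d) v x ⟩
    combℤ c v x + combℤ (-_ ∘ d) v x          ≡⟨ cong (_+_ (combℤ c v x)) (combℤ-neg d v x) ⟩
    combℤ c v x ℤ.- combℤ d v x               ≡⟨ ℤₚ.i≡j⇒i-j≡0 (eq x) ⟩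
    0ℤ                                        ∎

-- Span lattices, index 1 and primitive vectors.

-- The rational coefficients are `c i` divided by `M`. Every membership in a span lattice needed
-- below comes from an integer relation of this kind.
multiple⇒SpanLattice : ∀ {v : Vector (ℤ^ n) k} {w} M c → 0ℤ ℤ.< M →
  (∀ x → M * w x ≡ combℤ c v x) → SpanLattice v w
multiple⇒SpanLattice {v = v} {w} M c 0<M eq = (λ i → q ℚ.* fromℤ (c i)) , λ x → begin
  combℚ (λ i → q ℚ.* fromℤ (c i)) v x
    ≡⟨ ℚΣ⁺.sum-cong-≗ (λ i → ℚₚ.*-assoc q (fromℤ (c i)) (fromℤ (v i x))) ⟩
  sumℚ (λ i → q ℚ.* (fromℤ (c i) ℚ.* fromℤ (v i x)))
    ≡⟨ ℚΣ.*-distribˡ-sum q (λ i → fromℤ (c i) ℚ.* fromℤ (v i x)) ⟨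
  q ℚ.* combℚ (fromℤ ∘ c) v x
    ≡⟨ cong (q ℚ.*_) (combℚ-fromℤ c v x) ⟩
  q ℚ.* fromℤ (combℤ c v x)
    ≡⟨ cong (λ z → q ℚ.* fromℤ z) (eq x) ⟨
  q ℚ.* fromℤ (M * w x)
    ≡⟨ cong (q ℚ.*_) (fromℤ-* M (w x)) ⟩
  q ℚ.* (fromℤ M ℚ.* fromℤ (w x))
    ≡⟨ ℚₚ.*-assoc q (fromℤ M) (fromℤ (w x)) ⟨
  q ℚ.* fromℤ M ℚ.* fromℤ (w x)
    ≡⟨ cong (ℚ._* fromℤ (w x)) (ℚₚ.*-inverseˡ (fromℤ M)) ⟩
  1ℚ ℚ.* fromℤ (w x)
    ≡⟨ ℚₚ.*-identityˡ (fromℤ (w x)) ⟩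
  fromℤ (w x) ∎
  where
  instance
    M≢0 : ℚ.NonZero (fromℤ M)
    M≢0 = ℤ.>-nonZero 0<M
  q = 1/ fromℤ M

SpanLattice-cong : {v w : Vector (ℤ^ n) k} → (∀ i → v i ≗ w i) →
  ∀ {g} → SpanLattice v g → SpanLattice w g
SpanLattice-cong v≗w (c , eq) =
  c , λ x → trans (ℚΣ⁺.sum-cong-≗ (λ i → cong (λ z → c i ℚ.* fromℤ z) (sym (v≗w i x)))) (eq x)

-- The single representative may be any element of the lattice, so the coset of 0 is consulted as
-- well: `g` and 0 both differ from `rep zero` by elements of the ℤ-span, hence so do they from each
-- other.
index-1⇒spanning : {v : Vector (ℤ^ n) k} → HasIndex (SpanLattice v) (ℤ-Span v) 1 →
  ∀ {g} → SpanLattice v g → ℤ-Span v g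
index-1⇒spanning {v = v} (rep , _ , cosets) {g} g∈ with cosets g∈ | cosets zero∈
  where
  zero∈ : SpanLattice v (const 0ℤ)
  zero∈ = multiple⇒SpanLattice 1ℤ (const 0ℤ) (ℤ.+<+ (ℕ.s≤s ℕ.z≤n))
    (λ x → sym (combℤ-zero v (λ _ → refl) x))
... | zero , (c , c-eq) , _ | zero , (d , d-eq) , _ = (λ i → c i ℤ.- d i) , λ x → begin
  combℤ (λ i → c i ℤ.- d i) v x
    ≡⟨ combℤ-+ c (-_ ∘ d) v x ⟩
  combℤ c v x + combℤ (-_ ∘ d) v x
    ≡⟨ cong₂ _+_ (c-eq x) (trans (combℤ-neg d v x) (cong -_ (d-eq x))) ⟩
  (g x ℤ.- rep zero x) + - (0ℤ ℤ.- rep zero x)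
    ≡⟨ cancel (g x) (rep zero x) ⟩
  g x ∎
  where
  cancel : ∀ s t → (s + - t) + - (0ℤ + - t) ≡ s
  cancel = solve-∀

-- Index 1 gives `v` as an integer multiple `c` of the segment vector, which is itself `m` times
-- `v`. Thus `m` divides every coordinate of `v`, and primitivity forces `m` to be 1.
length-1⇒≗ : ∀ (A B : ℤ^ n) {v} → IntegerLength A B 1 → PrimitiveAlong (B -ᵥ A) v → v ≗ B -ᵥ A
length-1⇒≗ A B {v} len (prim , m , 0<m , AB≡mv) x = begin
  v x           ≡⟨ ℤₚ.*-identityˡ (v x) ⟨
  1ℤ * v x      ≡⟨ cong (λ z → + z * v x) m≡1 ⟨
  + m * v x     ≡⟨ AB≡mv x ⟨
  (B -ᵥ A) x    ∎
  where
  v∈ : ℤ-Span {k = 1} (const (B -ᵥ A)) v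
  v∈ = index-1⇒spanning {v = λ _ → B -ᵥ A} len
    (multiple⇒SpanLattice {v = λ _ → B -ᵥ A} (+ m) (const 1ℤ) (ℤ.+<+ 0<m)
    (λ y → trans (sym (AB≡mv y)) (sym (trans (ℤₚ.+-identityʳ _) (ℤₚ.*-identityˡ _)))))
  c = proj₁ v∈ zero
  m≡1 : m ≡ 1
  m≡1 = prim m (λ y → ∣⇒∣ᵤ {+ m} (divides (c * v y) (begin
    v y                            ≡⟨ proj₂ v∈ y ⟨
    c * (B -ᵥ A) y + 0ℤ            ≡⟨ ℤₚ.+-identityʳ _ ⟩
    c * (B -ᵥ A) y                 ≡⟨ cong (c *_) (AB≡mv y) ⟩
    c * (+ m * v y)                ≡⟨ swap c (+ m) (v y) ⟩
    c * v y * + m                  ∎)))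
    where
    swap : ∀ s t u → s * (t * u) ≡ s * u * t
    swap = solve-∀

-- Elementary facts on integers and on the last index.

positive-*≡1ˡ : ∀ {i j} → 0ℤ ℤ.< i → i * j ≡ 1ℤ → i ≡ 1ℤ
positive-*≡1ˡ {i} {j} 0<i eq = trans (sym (ℤₚ.0≤i⇒+∣i∣≡i (ℤₚ.<⇒≤ 0<i)))
  (cong +_ (ℕₚ.m*n≡1⇒m≡1 ℤ.∣ i ∣ ℤ.∣ j ∣ (trans (sym (ℤₚ.abs-* i j)) (cong ℤ.∣_∣ eq))))

0≤i<1⇒i≡0 : ∀ {i} → 0ℤ ℤ.≤ i → i ℤ.< 1ℤ → i ≡ 0ℤ
0≤i<1⇒i≡0 (ℤ.+≤+ _) (ℤ.+<+ i<1) = cong +_ (ℕₚ.n<1⇒n≡0 i<1)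

∣-antisym-positive : ∀ {i j} → 0ℤ ℤ.< i → 0ℤ ℤ.< j → i ∣ j → j ∣ i → i ≡ j
∣-antisym-positive 0<i 0<j i∣j j∣i =
  trans (sym (ℤₚ.0≤i⇒+∣i∣≡i (ℤₚ.<⇒≤ 0<i)))
    (trans (cong +_ (ℕᵈ.∣-antisym i∣j j∣i)) (ℤₚ.0≤i⇒+∣i∣≡i (ℤₚ.<⇒≤ 0<j)))

≢last⇒<last : (i : Fin (ℕ.suc k)) → i ≢ fromℕ k → i < fromℕ k
≢last⇒<last i i≢ = Finₚ.≤∧≢⇒< (Finₚ.≤fromℕ i) i≢

punchIn-last : (i : Fin k) → punchIn (fromℕ k) i ≡ inject₁ i
punchIn-last zero    = refl
punchIn-last (suc i) = cong suc (punchIn-last i)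

-- Phrased through an arbitrary primitive vector along the edge, so that it directly identifies the
-- primitive vectors stored in `HermiteBasis` and `IntegerSine` with the edges.
HasPrimitiveEdges : OrderedCone n k → Set
HasPrimitiveEdges α = ∀ i {v} → PrimitiveAlong (edge α i) v → v ≗ edge α i

-- The Hermite basis of a cone whose facet opposite the last edge has sine 1.

module HermiteLastColumn {n p : ℕ} (α : OrderedCone n (ℕ.suc p)) (unit : HasPrimitiveEdges α)
  (facet-sine : IntegerSine (facet α (fromℕ p)) 1) (H : HermiteBasis α) where

  open HermiteBasis H using (a; e; upper; diagonal; reduced)

  last : Fin (ℕ.suc p)
  last = fromℕ p

  N : ℤ
  N = a last last

  v : Vector (ℤ^ n) (ℕ.suc p)
  v = edge α

  injective : ∀ c d → combℤ c v ≗ combℤ d v → c ≗ d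
  injective c d = combℤ-injective v (OrderedCone.independent α)

  v-edges≗ : ∀ i → HermiteBasis.v H i ≗ v i
  v-edges≗ i = unit i (HermiteBasis.v-edges H i)

  expansion : ∀ i → combℤ (λ j → a j i) e ≗ v i
  expansion i x = trans (HermiteBasis.expansion H i x) (v-edges≗ i x)

  spanning : ∀ {w} → SpanLattice v w → ℤ-Span e w
  spanning = IsℤBasis.spanning (HermiteBasis.basis H)
    ∘ SpanLattice-cong {v = v} (λ i x → sym (v-edges≗ i x))

  -- With no component along the last edge, `w` lies in the span of the facet omitting that edge.
  -- This facet has sine 1, so its edges generate all integer vectors of its span; the coefficient
  -- vector `d` is then padded with 0 at `last`.
  facet-saturated : ∀ M {w} c → 0ℤ ℤ.< M → c last ≡ 0ℤ → (∀ x → M * w x ≡ combℤ c v x) →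
    ∃[ d ] w ≗ combℤ d v
  facet-saturated M {w} c 0<M cl≡0 eq = d , λ x → begin
    w x                                     ≡⟨ proj₂ w∈ x ⟨
    combℤ c′ u x                            ≡⟨ combℤ-congʳ c′ u≗ x ⟩
    combℤ c′ (removeAt v last) x            ≡⟨ combℤ-congˡ (removeAt v last)
                                                 (λ i → insertAt-punchIn c′ last 0ℤ i) x ⟨
    combℤ (removeAt d last) (removeAt v last) x
                                            ≡⟨ combℤ-remove-zero d v last (insertAt-lookup c′ last 0ℤ) x ⟨
    combℤ d v x                             ∎
    where
    u = proj₁ facet-sine
    u≗ : ∀ i → u i ≗ removeAt v last i
    u≗ i = unit (punchIn last i) (proj₁ (proj₂ facet-sine) i)
    w∈ : ℤ-Span u w
    w∈ = index-1⇒spanning (proj₂ (proj₂ facet-sine))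
      (multiple⇒SpanLattice M (removeAt c last) 0<M (λ x → begin
        M * w x                                      ≡⟨ eq x ⟩
        combℤ c v x                                  ≡⟨ combℤ-remove-zero c v last cl≡0 x ⟩
        combℤ (removeAt c last) (removeAt v last) x  ≡⟨ combℤ-congʳ (removeAt c last) u≗ x ⟨
        combℤ (removeAt c last) u x                  ∎))
    c′ = proj₁ w∈
    d = insertAt c′ last 0ℤ

  -- The coordinates of a r r · e r in the edge vectors, once e j = v j for j < r.
  column : Fin (ℕ.suc p) → Vector ℤ (ℕ.suc p)
  column r = updateAt (λ j → - a j r) r (const 1ℤ)

  column-diagonal : ∀ r → column r r ≡ 1ℤ
  column-diagonal r = updateAt-updates r (λ j → - a j r)

  column-off : ∀ {r j} → j ≢ r → column r j ≡ - a j r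
  column-off {r} {j} j≢r = updateAt-minimal j r (λ j → - a j r) j≢r

  -- This is the expansion of `v r` solved for its diagonal term: for j < r the basis vectors are
  -- already edges, and for j > r the coefficients vanish by triangularity. It serves both inside
  -- the induction on `r` and, at its end, for `last`.
  diagonal-multiple : ∀ r → (∀ {j} → j < r → e j ≗ v j) →
    ∀ x → a r r * e r x ≡ combℤ (column r) v x
  diagonal-multiple r e≗v x = begin
    a r r * e r x                                ≡⟨ move (a r r * e r x) S (v r x)
                                                      (trans (sym (combℤ-remove (λ j → a j r) e r x)) (expansion r x)) ⟩
    1ℤ * v r x + - S                             ≡⟨ cong₂ _+_ (cong (_* v r x) (column-diagonal r)) tail ⟨
    column r r * v r x + combℤ (removeAt (column r) r) (removeAt v r) x
                                                 ≡⟨ combℤ-remove (column r) v r x ⟨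
    combℤ (column r) v x                         ∎
    where
    S = combℤ (removeAt (λ j → a j r) r) (removeAt e r) x
    move : ∀ s t u → s + t ≡ u → s ≡ 1ℤ * u + - t
    move s t _ refl = move′ s t
      where
      move′ : ∀ s t → s ≡ 1ℤ * (s + t) + - t
      move′ = solve-∀
    term : ∀ j → j ≢ r → column r j * v j x ≡ - a j r * e j x
    term j j≢r with Finₚ.<-cmp j r
    ... | tri< j<r _ _ = cong₂ _*_ (column-off j≢r) (sym (e≗v j<r x))
    ... | tri≈ _ j≡r _ = contradiction j≡r j≢r
    ... | tri> _ _ r<j = begin
      column r j * v j x  ≡⟨ cong (_* v j x) (trans (column-off j≢r) (cong -_ (upper r<j))) ⟩
      0ℤ * v j x          ≡⟨ cong (λ z → - z * e j x) (upper r<j) ⟨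
      - a j r * e j x     ∎
    tail : combℤ (removeAt (column r) r) (removeAt v r) x ≡ - S
    tail = trans (ℤΣ⁺.sum-cong-≗ (λ i → term (punchIn r i) (Finₚ.punchInᵢ≢i r i)))
      (combℤ-neg (removeAt (λ j → a j r) r) (removeAt e r) x)

  -- By well-founded induction, saturation of the facet makes `e r` an integer combination of edges.
  -- Comparing coefficients of `v r` gives `a r r * d r ≡ 1`, so the diagonal entry is 1. The
  -- reduced entries above it then lie in [0, 1) and vanish, which leaves `e r` alone in the
  -- expansion of `v r`.
  e≗v-below : ∀ r → Acc _<_ r → r < last → e r ≗ v r
  e≗v-below r (acc rs) r<last x = begin
    e r x                 ≡⟨ ℤₚ.*-identityˡ (e r x) ⟨
    1ℤ * e r x            ≡⟨ cong (_* e r x) arr≡1 ⟨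
    a r r * e r x         ≡⟨ ℤₚ.+-identityʳ _ ⟨
    a r r * e r x + 0ℤ    ≡⟨ cong (_+_ (a r r * e r x)) rest≡0 ⟨
    a r r * e r x + combℤ (removeAt (λ j → a j r) r) (removeAt e r) x
                          ≡⟨ combℤ-remove (λ j → a j r) e r x ⟨
    combℤ (λ j → a j r) e x ≡⟨ expansion r x ⟩
    v r x                 ∎
    where
    multiple : ∀ x → a r r * e r x ≡ combℤ (column r) v x
    multiple = diagonal-multiple r
      (λ {j} j<r → e≗v-below j (rs j<r) (Finₚ.<-trans j<r r<last))
    -- The coefficient at `last` is minus an entry below the diagonal of column `r`, hence 0.
    saturated = facet-saturated (a r r) (column r) (diagonal r)
      (trans (column-off (Finₚ.<⇒≢ r<last ∘ sym)) (cong -_ (upper r<last))) multiple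
    d = proj₁ saturated
    arr≡1 : a r r ≡ 1ℤ
    arr≡1 = positive-*≡1ˡ {j = d r} (diagonal r) (trans
      (injective (λ i → a r r * d i) (column r) (λ y → begin
      combℤ (λ i → a r r * d i) v y  ≡⟨ combℤ-scale (a r r) d v y ⟨
      a r r * combℤ d v y            ≡⟨ cong (a r r *_) (proj₂ saturated y) ⟨
      a r r * e r y                  ≡⟨ multiple y ⟩
      combℤ (column r) v y           ∎) r) (column-diagonal r))
    off≡0 : ∀ j → j ≢ r → a j r ≡ 0ℤ
    off≡0 j j≢r with Finₚ.<-cmp j r
    ... | tri< j<r _ _ = 0≤i<1⇒i≡0 (proj₁ (reduced j<r))
      (subst (a j r ℤ.<_) arr≡1 (proj₂ (reduced j<r)))
    ... | tri≈ _ j≡r _ = contradiction j≡r j≢r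
    ... | tri> _ _ r<j = upper r<j
    rest≡0 : combℤ (removeAt (λ j → a j r) r) (removeAt e r) x ≡ 0ℤ
    rest≡0 = combℤ-zero (removeAt e r) (λ i → off≡0 _ (Finₚ.punchInᵢ≢i r i)) x

  e≗v : ∀ {r} → r < last → e r ≗ v r
  e≗v {r} = e≗v-below r (<-wellFounded r)

  N-multiple : ∀ x → N * e last x ≡ combℤ (column last) v x
  N-multiple = diagonal-multiple last e≗v

  -- The quotients are the coordinates `y` of `w` in the Hermite basis. Intended for `w` the last
  -- Hermite vector of a second cone spanning the same lattice and `M` the last sine of that cone.
  divisibility : ∀ M w b → 0ℤ ℤ.< M → b last ≡ 1ℤ → (∀ x → M * w x ≡ combℤ b v x) →
    M ∣ N × (∀ j → j < last → M ∣ a j last + b j)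
  divisibility M w b 0<M bl≡1 eq =
    ∣⇒∣ᵤ (divides (y last) (trans (sym M*y≡N) (ℤₚ.*-comm M (y last)))) ,
    λ j j<last → ∣⇒∣ᵤ (divides (y j) (begin
      a j last + b j                 ≡⟨ cong (_+_ (a j last)) (below j j<last) ⟩
      a j last + (M * y j + - a j last) ≡⟨ cancel (a j last) M (y j) ⟩
      y j * M                        ∎))
    where
    cancel : ∀ a M y → a + (M * y + - a) ≡ y * M
    cancel = solve-∀
    instance
      N≢0 : ℤ.NonZero N
      N≢0 = ℤ.>-nonZero (diagonal last)
    w∈ = spanning (multiple⇒SpanLattice {v = v} {w} M b 0<M eq)
    y = proj₁ w∈
    -- Below `last` the basis vectors are edges, so `y′` collects the part of `w` already expressed
    -- in edges; only the multiple of `e last` remains.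
    y′ = updateAt y last (const 0ℤ)
    y-split : ∀ x → w x ≡ y last * e last x + combℤ y′ v x
    y-split x = begin
      w x                                ≡⟨ proj₂ w∈ x ⟨
      combℤ y e x                        ≡⟨ combℤ-remove y e last x ⟩
      y last * e last x + combℤ (removeAt y last) (removeAt e last) x
        ≡⟨ cong (_+_ (y last * e last x)) (ℤΣ⁺.sum-cong-≗ (λ i → cong₂ _*_
             (sym (updateAt-minimal (punchIn last i) last y (Finₚ.punchInᵢ≢i last i)))
             (e≗v (≢last⇒<last _ (Finₚ.punchInᵢ≢i last i)) x))) ⟩
      y last * e last x + combℤ (removeAt y′ last) (removeAt v last) x
        ≡⟨ cong (_+_ (y last * e last x)) (combℤ-remove-zero y′ v last (updateAt-updates last y) x) ⟨
      y last * e last x + combℤ y′ v x   ∎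
    -- Multiplying by `N` turns the remaining `e last` into a combination of edges, by `N-multiple`.
    N-w : ∀ x → N * w x ≡ combℤ (λ j → N * y′ j + y last * column last j) v x
    N-w x = begin
      N * w x
        ≡⟨ cong (N *_) (y-split x) ⟩
      N * (y last * e last x + combℤ y′ v x)
        ≡⟨ shuffle N (y last) (e last x) (combℤ y′ v x) ⟩
      N * combℤ y′ v x + y last * (N * e last x)
        ≡⟨ cong (λ z → N * combℤ y′ v x + y last * z) (N-multiple x) ⟩
      N * combℤ y′ v x + y last * combℤ (column last) v x
        ≡⟨ cong₂ _+_ (combℤ-scale N y′ v x) (combℤ-scale (y last) (column last) v x) ⟩
      combℤ (λ j → N * y′ j) v x + combℤ (λ j → y last * column last j) v x
        ≡⟨ combℤ-+ (λ j → N * y′ j) (λ j → y last * column last j) v x ⟨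
      combℤ (λ j → N * y′ j + y last * column last j) v x ∎
      where
      shuffle : ∀ N y e s → N * (y * e + s) ≡ N * s + y * (N * e)
      shuffle = solve-∀
    -- Both sides are the coordinates of `M * N * w` in the independent edges.
    coefficients : ∀ j → M * (N * y′ j + y last * column last j) ≡ N * b j
    coefficients = injective _ _ (λ x → begin
      combℤ (λ j → M * (N * y′ j + y last * column last j)) v x
        ≡⟨ combℤ-scale M (λ j → N * y′ j + y last * column last j) v x ⟨
      M * combℤ (λ j → N * y′ j + y last * column last j) v x
        ≡⟨ cong (M *_) (N-w x) ⟨
      M * (N * w x)
        ≡⟨ swap M N (w x) ⟩
      N * (M * w x)
        ≡⟨ cong (N *_) (eq x) ⟩
      N * combℤ b v x
        ≡⟨ combℤ-scale N b v x ⟩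
      combℤ (λ j → N * b j) v x ∎)
      where
      swap : ∀ s t u → s * (t * u) ≡ t * (s * u)
      swap = solve-∀
    M*y≡N : M * y last ≡ N
    M*y≡N = begin
      M * y last                     ≡⟨ insert-zero M N (y last) ⟩
      M * (N * 0ℤ + y last * 1ℤ)     ≡⟨ cong₂ (λ s t → M * (N * s + y last * t))
                                        (updateAt-updates last y) (column-diagonal last) ⟨
      M * (N * y′ last + y last * column last last) ≡⟨ coefficients last ⟩
      N * b last                     ≡⟨ cong (N *_) bl≡1 ⟩
      N * 1ℤ                         ≡⟨ ℤₚ.*-identityʳ N ⟩
      N                              ∎
      where
      insert-zero : ∀ M N y → M * y ≡ M * (N * 0ℤ + y * 1ℤ)
      insert-zero = solve-∀
    below : ∀ j → j < last → b j ≡ M * y j + - a j last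
    below j j<last = ℤₚ.*-cancelˡ-≡ N _ _ (begin
      N * b j                                      ≡⟨ coefficients j ⟨
      M * (N * y′ j + y last * column last j)      ≡⟨ cong₂ (λ s t → M * (N * s + y last * t))
                                                      (updateAt-minimal j last y j≢) (column-off j≢) ⟩
      M * (N * y j + y last * - a j last)          ≡⟨ expand M N (y j) (y last) (a j last) ⟩
      N * (M * y j) + (M * y last) * - a j last    ≡⟨ cong (λ z → N * (M * y j) + z * - a j last) M*y≡N ⟩
      N * (M * y j) + N * - a j last               ≡⟨ ℤₚ.*-distribˡ-+ N (M * y j) (- a j last) ⟨
      N * (M * y j + - a j last)                   ∎)
      where
      j≢ = Finₚ.<⇒≢ j<last
      expand : ∀ M N s t a → M * (N * s + t * - a) ≡ N * (M * s) + (M * t) * - a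
      expand = solve-∀

-- The change of vertex from one end of an edge to the other.

-- A relation between two edge families rather than a function, so that by `Flip-sym` the comparison
-- of the cones can be run in both directions on the given edges.
record Flip (v v′ : Vector (ℤ^ n) (ℕ.suc k)) : Set where
  field
    head : ∀ x → v′ zero x ≡ - v zero x
    tail : ∀ i x → v′ (suc i) x ≡ v (suc i) x ℤ.- v zero x

Flip-sym : {v v′ : Vector (ℤ^ n) (ℕ.suc k)} → Flip v v′ → Flip v′ v
Flip-sym {v = v} {v′} fl = record
  { head = λ x → trans (sym (ℤₚ.neg-involutive (v zero x))) (cong -_ (sym (head x)))
  ; tail = λ i x → begin
      v (suc i) x                                    ≡⟨ split (v (suc i) x) (v zero x) ⟩
      v (suc i) x ℤ.- v zero x ℤ.- (- v zero x)      ≡⟨ cong₂ ℤ._-_ (tail i x) (head x) ⟨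
      v′ (suc i) x ℤ.- v′ zero x                     ∎ }
  where
  open Flip fl
  split : ∀ s t → s ≡ s + - t + - (- t)
  split = solve-∀

-- The action of the flip on coordinates: each flipped vector contributes exactly one `- v zero`, so
-- the first coordinate collects minus the sum of all coefficients and the others are unchanged.
flipCoefficients : Vector ℤ (ℕ.suc k) → Vector ℤ (ℕ.suc k)
flipCoefficients c zero    = - sumℤ c
flipCoefficients c (suc i) = c (suc i)

Flip-comb : {v v′ : Vector (ℤ^ n) (ℕ.suc k)} → Flip v v′ → ∀ c →
  combℤ c v′ ≗ combℤ (flipCoefficients c) v
Flip-comb {v = v} {v′} fl c x = begin
  c zero * v′ zero x + sumℤ (λ i → c (suc i) * v′ (suc i) x)
    ≡⟨ cong₂ _+_ (cong (c zero *_) (Flip.head fl x)) (ℤΣ⁺.sum-cong-≗ (λ i →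
         trans (cong (c (suc i) *_) (Flip.tail fl i x))
           (ℤₚ.*-distribˡ-+ (c (suc i)) (v (suc i) x) (- v zero x)))) ⟩
  c zero * - v zero x + sumℤ (λ i → c (suc i) * v (suc i) x + c (suc i) * - v zero x)
    ≡⟨ cong (_+_ (c zero * - v zero x))
         (ℤΣ⁺.∑-distrib-+ (λ i → c (suc i) * v (suc i) x) (λ i → c (suc i) * - v zero x)) ⟩
  c zero * - v zero x + (S + sumℤ (λ i → c (suc i) * - v zero x))
    ≡⟨ cong (λ z → c zero * - v zero x + (S + z)) (ℤΣ.*-distribʳ-sum (- v zero x) (c ∘ suc)) ⟨
  c zero * - v zero x + (S + sumℤ (c ∘ suc) * - v zero x)
    ≡⟨ regroup (c zero) (v zero x) S (sumℤ (c ∘ suc)) ⟩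
  - (c zero + sumℤ (c ∘ suc)) * v zero x + S ∎
  where
  S = sumℤ (λ i → c (suc i) * v (suc i) x)
  regroup : ∀ c v S T → c * - v + (S + T * - v) ≡ - (c + T) * v + S
  regroup = solve-∀

-- Comparison of the last Hermite columns of two flipped cones.

module _ {n m : ℕ} {α β : OrderedCone n (2 ℕ.+ m)}
  (unitα : HasPrimitiveEdges α) (unitβ : HasPrimitiveEdges β)
  (facetα : IntegerSine (facet α (fromℕ (ℕ.suc m))) 1)
  (facetβ : IntegerSine (facet β (fromℕ (ℕ.suc m))) 1)
  (Hα : HermiteBasis α) (Hβ : HermiteBasis β) (fl : Flip (edge α) (edge β)) where

  private
    module A = HermiteLastColumn α unitα facetα Hα
    module B = HermiteLastColumn β unitβ facetβ Hβ
    b = flipCoefficients (B.column B.last)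
    -- The dimension is at least 2, so the last index is a successor. The flip therefore leaves the
    -- last coefficient as it is, and it stays equal to 1.
    divisibility = A.divisibility B.N (HermiteBasis.e Hβ B.last) b
      (HermiteBasis.diagonal Hβ B.last) (B.column-diagonal B.last)
      (λ x → trans (B.N-multiple x) (Flip-comb fl (B.column B.last) x))

  flip-lsin-∣ : B.N ∣ A.N
  flip-lsin-∣ = proj₁ divisibility

  -- The first coefficient of the flipped column is minus the sum of the whole column of `β`. That
  -- column has 1 on the diagonal and minus the cosines above it, so the coefficient is `S` minus 1.
  flip-lcos-first : B.N ∣ lcos Hα 0F A.last + sumℤ (λ i → lcos Hβ (inject₁ i) A.last) ℤ.- 1ℤ
  flip-lcos-first = subst (B.N ∣_) eq (proj₂ divisibility 0F (ℕ.s≤s ℕ.z≤n))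
    where
    c = B.column B.last
    S = sumℤ (λ i → lcos Hβ (inject₁ i) A.last)
    sum-column : sumℤ c ≡ 1ℤ + - S
    sum-column = begin
      sumℤ c                                     ≡⟨ ℤΣ⁺.sum-remove {i = B.last} c ⟩
      c B.last + sumℤ (removeAt c B.last)
        ≡⟨ cong₂ _+_ (B.column-diagonal B.last) (ℤΣ⁺.sum-cong-≗ (λ i → begin
             c (punchIn B.last i)                  ≡⟨ B.column-off (Finₚ.punchInᵢ≢i B.last i) ⟩
             - lcos Hβ (punchIn B.last i) B.last   ≡⟨ cong (λ j → - lcos Hβ j B.last) (punchIn-last i) ⟩
             - lcos Hβ (inject₁ i) B.last          ≡⟨ ℤₚ.-1*i≡-i _ ⟨
             - 1ℤ * lcos Hβ (inject₁ i) B.last     ∎)) ⟩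
      1ℤ + sumℤ (λ i → - 1ℤ * lcos Hβ (inject₁ i) B.last)
        ≡⟨ cong (_+_ 1ℤ) (ℤΣ.*-distribˡ-sum (- 1ℤ) (λ i → lcos Hβ (inject₁ i) B.last)) ⟨
      1ℤ + - 1ℤ * S                              ≡⟨ cong (_+_ 1ℤ) (ℤₚ.-1*i≡-i S) ⟩
      1ℤ + - S                                   ∎
    eq : lcos Hα 0F A.last + - sumℤ c ≡ lcos Hα 0F A.last + S ℤ.- 1ℤ
    eq = trans (cong (λ z → lcos Hα 0F A.last + - z) sum-column) (shape (lcos Hα 0F A.last) S)
      where
      shape : ∀ s t → s + - (1ℤ + - t) ≡ s + t + - 1ℤ
      shape = solve-∀

  -- The flip changes only the first coordinate, so here the coefficient is still minus the cosine
  -- of `β`.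
  flip-lcos-middle : ∀ i → suc i < A.last → B.N ∣ lcos Hα (suc i) A.last ℤ.- lcos Hβ (suc i) A.last
  flip-lcos-middle i i<last = subst (λ z → B.N ∣ lcos Hα (suc i) A.last + z)
    (B.column-off (Finₚ.<⇒≢ i<last)) (proj₂ divisibility (suc i) i<last)

-- Uniqueness of residues, and the three relations for the simplex.

-- The absolute difference is at most the maximum of `i` and `j`, hence below `N`; a multiple of `N`
-- that small is 0.
residue-unique : ∀ {N i j} → 0ℤ ℤ.≤ i → i ℤ.< N → 0ℤ ℤ.≤ j → j ℤ.< N → N ∣ i ℤ.- j → i ≡ j
residue-unique {i = + i} {+ j} (ℤ.+≤+ _) (ℤ.+<+ {n = N} i<N) (ℤ.+≤+ _) (ℤ.+<+ j<N) N∣i-j =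
  ℤₚ.i-j≡0⇒i≡j (+ i) (+ j) (ℤₚ.∣i∣≡0⇒i≡0 (∣∧<⇒≡0 N∣i-j (subst (λ z → ℤ.∣ z ∣ ℕ.< N)
    (sym (ℤₚ.m-n≡m⊖n i j)) (ℕₚ.≤-<-trans (ℤₚ.∣m⊝n∣≤m⊔n i j) (ℕₚ.⊔-lub i<N j<N)))))
  where
  ∣∧<⇒≡0 : ∀ {d} → N ℕᵈ.∣ d → d ℕ.< N → d ≡ 0
  ∣∧<⇒≡0 {ℕ.zero}  _   _   = refl
  ∣∧<⇒≡0 {ℕ.suc d} N∣d d<N = contradiction N∣d (ℕᵈ.>⇒∤ d<N)

proposition3p19 : ∀ (n m : ℕ) (let k = 2 ℕ.+ m)
    (A : Vector (ℤ^ n) (1 ℕ.+ k)) (nondegenerate : AffinelyIndependent A) →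
    (∀ i j → i ≢ j → IntegerLength (A i) (A j) 1) →
    let
    α : OrderedCone n k
    α = ∠ (A 0F) (removeAt A 0F) (edges-independent A nondegenerate 0F)
    β : OrderedCone n k
    β = ∠ (A 1F) (removeAt A 1F) (edges-independent A nondegenerate 1F)
    first : Fin k
    first = 0F
    last : Fin k
    last = fromℕ (1 ℕ.+ m)
    in
    Simple α → Simple β →
    (Hα : HermiteBasis α) (Hβ : HermiteBasis β) →
    (lsin Hβ last ≡ lsin Hα last) ×
    (lcos Hβ first last + sumℤ (λ (i : Fin (1 ℕ.+ m)) → lcos Hα (inject₁ i) last) ≡ 1ℤ [mod lsin Hα last ]) ×
    (∀ x → first < x → x < last → lcos Hβ x last ≡ lcos Hα x last)
proposition3p19 n m A nondegenerate unit simpleα simpleβ Hα Hβ =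
  -- The cones enter in swapped roles: the modulus in `flip-lcos-first` is the sine of the second
  -- cone and the sum runs over its cosines, so `α` must come second.
  lsin≡ , flip-lcos-first unitβ unitα facetβ facetα Hβ Hα β→α , middle
  where
  first last : Fin (2 ℕ.+ m)
  first = 0F
  last = fromℕ (1 ℕ.+ m)
  α = ∠ (A 0F) (removeAt A 0F) (edges-independent A nondegenerate 0F)
  β = ∠ (A 1F) (removeAt A 1F) (edges-independent A nondegenerate 1F)
  unitα : HasPrimitiveEdges α
  unitα i = length-1⇒≗ (A 0F) (A (suc i)) (unit 0F (suc i) (λ ()))
  unitβ : HasPrimitiveEdges β
  unitβ i = length-1⇒≗ (A 1F) (A (punchIn 1F i))
    (unit 1F (punchIn 1F i) (Finₚ.punchInᵢ≢i 1F i ∘ sym))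
  facetα = simpleα last
  facetβ = simpleβ last
  -- `removeAt A 1F` lists `A 0F` first and then the vertices shared with `α`. The first edge is
  -- thus reversed, and every other edge changes by `A 1F -ᵥ A 0F`.
  α→β : Flip (edge α) (edge β)
  α→β = record
    { head = λ x → swap (A 0F x) (A 1F x)
    ; tail = λ i x → triangle (A (suc (suc i)) x) (A 0F x) (A 1F x) }
    where
    swap : ∀ s t → s + - t ≡ - (t + - s)
    swap = solve-∀
    triangle : ∀ u s t → u + - t ≡ (u + - s) + - (t + - s)
    triangle = solve-∀
  β→α : Flip (edge β) (edge α)
  β→α = Flip-sym {v = edge α} {edge β} α→β
  lsin≡ : lsin Hβ last ≡ lsin Hα last
  lsin≡ = ∣-antisym-positive (HermiteBasis.diagonal Hβ last) (HermiteBasis.diagonal Hα last)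
    (flip-lsin-∣ unitα unitβ facetα facetβ Hα Hβ α→β)
    (flip-lsin-∣ unitβ unitα facetβ facetα Hβ Hα β→α)
  middle : ∀ x → first < x → x < last → lcos Hβ x last ≡ lcos Hα x last
  middle (suc i) _ i<last = residue-unique
    (proj₁ (HermiteBasis.reduced Hβ i<last))
    -- The cosine of `β` is reduced modulo its own sine; equality of the sines puts both cosines in
    -- the same residue range.
    (subst (lcos Hβ (suc i) last ℤ.<_) lsin≡ (proj₂ (HermiteBasis.reduced Hβ i<last)))
    (proj₁ (HermiteBasis.reduced Hα i<last))
    (proj₂ (HermiteBasis.reduced Hα i<last))
    (flip-lcos-middle unitβ unitα facetβ facetα Hβ Hα β→α i i<last)
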